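{- For every $n\ge1$ and every $\pi\in\mathrm{PC}(n)$ let $a(\pi)\in\mathbb{C}$ be an arbitrary complex number, and let $a_n=\sum_{\pi\in\mathrm{PC}(n)}a(\pi)$, $A(x)=\sum_{n=1}^\infty a_nx^n$. Let $b(\pi)$, for $\pi\in\mathrm{PC}^+(n)$, be the associated weights described in the context, and let $b_n=\sum_{\pi\in\mathrm{PC}^+(n)}b(\pi)$, $B(x)=\sum_{n=1}^\infty b_nx^n$. Then $b_1=1$ and, for every $n\ge2$, $b_n=a_n+a_{n-1}$. Thus, as formal power series, $$B(x)=x+(1+x)A(x).$$
   Context: $[n]=\{1,\ldots,n\}$ and $\mathcal{P}(n)$ is the set of all set partitions of $[n]$. For $\pi\in\mathcal{P}(n)$, write $i\overset{\pi}{\sim}j$ if $i,j$ lie in the same block of $\pi$. A subset $S\subseteq[n]$ splits $\pi$ if $S$ is a union of some of the blocks of $\pi$. Consider, for $\pi\in\mathcal{P}(n)$, $n\ge1$, the conditions: (a) no proper subinterval $\{p+1,p+2,\ldots,p+q\}$ of $[n]$ (with $0\le p<p+q\le n$ and $q<n$) splits $\pi$; (b) $k\not\overset{\pi}{\sim}k+1$ for all $k\in[n-1]$; (c) $1\not\overset{\pi}{\sim}n$. $\mathrm{PC}(n)$ (the purely crossing partitions) is the set of $\pi\in\mathcal{P}(n)$ satisfying (a), (b) and (c). $\mathrm{PC}^+(n)$ is the set of $\pi\in\mathcal{P}(n)$ satisfying (a) and (b). (Since $1\sim 1$, $\mathrm{PC}(1)=\emptyset$.) $0_1$ denotes the unique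 partition of $[1]$. One has $\mathrm{PC}^+(1)=\{0_1\}$ and, for $n\ge2$, $\mathrm{PC}^+(n)$ is the disjoint union of $\mathrm{PC}(n)$ and $\{\tilde\sigma\mid\sigma\in\mathrm{PC}(n-1)\}$, where $\tilde\sigma$ is obtained from $\sigma$ by adjoining $n$ to the block of $\sigma$ that contains $1$. Weights: $b(0_1)=1$; for $n\ge2$ and $\pi\in\mathrm{PC}^+(n)$, $b(\pi)=a(\pi)$ if $\pi\in\mathrm{PC}(n)$, and $b(\pi)=a(\sigma)$ if $\pi=\tilde\sigma$ with $\sigma\in\mathrm{PC}(n-1)$. -}

module Defs where

open import Algebra.Bundles using (CommutativeRing)
import Algebra.Properties.Monoid.Sum as MonoidSum
open import Data.Bool.Base using (Bool; true; false)
import Data.Bool.Properties as Bool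
open import Data.Fin.Base using (Fin; zero; suc; toℕ; inject₁; fromℕ)
open import Data.Fin.Properties using (all?; any?; toℕ<n; toℕ-inject₁; toℕ-fromℕ)
open import Data.Fin.Relation.Unary.Top using (view; ‵fromℕ; ‵inject₁)
open import Data.Fin.Subset using (Subset; _∈_)
open import Data.Fin.Subset.Properties using (_∈?_; anySubset?)
open import Data.Irrelevant using (Irrelevant; [_])
open import Data.List.Base as List using (List; cartesianProductWith)
open import Data.Nat.Base using (ℕ; zero; suc; _+_; _∸_; _≤_; _<_; z≤n; s≤s; NonZero)
open import Data.Nat.Properties as ℕ using (_≤?_; _<?_)
open import Data.Product.Base using (∃; _×_; _,_; proj₁; proj₂)
open import Data.Refinement using (Refinement; Refinement-syntax; value; proof; _,_)
open import Data.Vec.Base as Vec using (Vec; []; _∷_; _∷ʳ_; lookup; tabulate)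
open import Data.Vec.Properties
  using (≡-dec; lookup-map; lookup∘tabulate; tabulate-cong; tabulate∘lookup; lookup⇒[]=; []=⇒lookup)
open import Function.Base using (_∘_)
open import Function.Bundles using (_⇔_; mk⇔; Equivalence)
open import Level using (Level)
open import Relation.Binary.PropositionalEquality
open import Relation.Nullary using (¬_; Dec; yes; no; contradiction)
open import Relation.Nullary.Decidable using (map′; ⌊_⌋; ¬?; _×-dec_; _→-dec_; recompute)
open import Relation.Unary using (Pred; Decidable)

private
  variable
    ℓ ℓ′ : Level
    n : ℕ

-- [n] is Fin n, so k ∈ [n] is the index with toℕ equal to k - 1.
-- A partition is stored as the family sending each i to the block that
-- contains i; two partitions are equal iff their families are.

Blocks : ℕ → Set
Blocks n = Vec (Subset n) n

block : Blocks n → Fin n → Subset n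
block = lookup

IsPartition : Blocks n → Set
IsPartition π = (∀ i → i ∈ block π i) × (∀ i j → j ∈ block π i → block π i ≡ block π j)

𝒫 : ℕ → Set
𝒫 n = [ π ∈ Blocks n ∣ IsPartition π ]

infix 4 _∼[_]_

_∼[_]_ : Fin n → 𝒫 n → Fin n → Set
i ∼[ π ] j = j ∈ block (value π) i

-- S is the union of the blocks containing a member of some T.
_Splits_ : Subset n → 𝒫 n → Set
S Splits π = ∃ λ T → ∀ j → j ∈ S ⇔ ∃ λ i → i ∈ T × j ∈ block (value π) i

-- {p+1, …, p+q}
interval : ℕ → ℕ → Subset n
interval p q = tabulate λ i → ⌊ (p ≤? toℕ i) ×-dec (toℕ i <? p + q) ⌋

NoIntervalSplits : Pred (𝒫 n) _
NoIntervalSplits {n} π =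
  ∀ p q → p < p + q → p + q ≤ n → q < n → ¬ (interval p q Splits π)

NoAdjacent : Pred (𝒫 n) _
NoAdjacent π = ∀ i j → toℕ j ≡ suc (toℕ i) → ¬ (i ∼[ π ] j)

EndsApart : Pred (𝒫 n) _
EndsApart {n} π = ∀ i j → toℕ i ≡ 0 → suc (toℕ j) ≡ n → ¬ (i ∼[ π ] j)

IsPC⁺ IsPC : Pred (𝒫 n) _
IsPC⁺ π = NoIntervalSplits π × NoAdjacent π
IsPC  π = NoIntervalSplits π × NoAdjacent π × EndsApart π

PC⁺ PC : ℕ → Set
PC⁺ n = [ π ∈ 𝒫 n ∣ IsPC⁺ π ]
PC  n = [ π ∈ 𝒫 n ∣ IsPC π ]

isPartition? : Decidable (IsPartition {n})
isPartition? π =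
  all? (λ i → i ∈? block π i) ×-dec
  all? (λ i → all? λ j → (j ∈? block π i) →-dec ≡-dec Bool._≟_ (block π i) (block π j))

splits? : (S : Subset n) (π : 𝒫 n) → Dec (S Splits π)
splits? S π = anySubset? λ T → all? λ j →
  let union? = any? λ i → (i ∈? T) ×-dec (j ∈? block (value π) i) in
  map′ (λ (f , g) → mk⇔ f g) (λ e → Equivalence.to e , Equivalence.from e)
    (((j ∈? S) →-dec union?) ×-dec (union? →-dec (j ∈? S)))

noIntervalSplits? : Decidable (NoIntervalSplits {n})
noIntervalSplits? {n} π = map′
  (λ h p q p<p+q p+q≤n q<n → h (ℕ.<-≤-trans p<p+q p+q≤n) q<n p<p+q p+q≤n)
  (λ h {p} _ {q} q<n p<p+q p+q≤n → h p q p<p+q p+q≤n q<n)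
  (ℕ.allUpTo? (λ p → ℕ.allUpTo? (λ q →
    (p <? p + q) →-dec ((p + q ≤? n) →-dec ¬? (splits? (interval p q) π))) n) n)

noAdjacent? : Decidable (NoAdjacent {n})
noAdjacent? π = all? λ i → all? λ j →
  (toℕ j ℕ.≟ suc (toℕ i)) →-dec ¬? (j ∈? block (value π) i)

endsApart? : Decidable (EndsApart {n})
endsApart? {n} π = all? λ i → all? λ j →
  (toℕ i ℕ.≟ 0) →-dec ((suc (toℕ j) ℕ.≟ n) →-dec ¬? (j ∈? block (value π) i))

isPC⁺? : Decidable (IsPC⁺ {n})
isPC⁺? π = noIntervalSplits? π ×-dec noAdjacent? π

isPC? : Decidable (IsPC {n})
isPC? π = noIntervalSplits? π ×-dec noAdjacent? π ×-dec endsApart? π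

-- Given a list without repetition, allVecs and comprehension return one, so
-- all𝒫, allPC⁺ and allPC list each of their elements exactly once.
allVecs : {A : Set ℓ} → List A → ∀ n → List (Vec A n)
allVecs xs zero    = List.[ [] ]
allVecs xs (suc n) = cartesianProductWith _∷_ xs (allVecs xs n)

comprehension : {A : Set ℓ} {P : Pred A ℓ′} → Decidable P → List A → List [ x ∈ A ∣ P x ]
comprehension P? List.[] = List.[]
comprehension P? (x List.∷ xs) with P? x
... | yes p = (x , [ p ]) List.∷ comprehension P? xs
... | no  _ = comprehension P? xs

allSubsets : ∀ n → List (Subset n)
allSubsets = allVecs (false List.∷ true List.∷ List.[])

all𝒫 : ∀ n → List (𝒫 n)
all𝒫 n = comprehension isPartition? (allVecs (allSubsets n) n)

allPC⁺ : ∀ n → List (PC⁺ n)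
allPC⁺ n = comprehension isPC⁺? (all𝒫 n)

allPC : ∀ n → List (PC n)
allPC n = comprehension isPC? (all𝒫 n)

-- Each set acquires the new last element iff it contains the first one.
adjoin : Subset (suc n) → Subset (suc (suc n))
adjoin S = S ∷ʳ lookup S zero

adjoinBlocks : Blocks (suc n) → Blocks (suc (suc n))
adjoinBlocks π = Vec.map adjoin π ∷ʳ adjoin (block π zero)

-- Sends the last point to the first and fixes the others, so that adjoinBlocks π
-- is the pullback of π along it.
retract : Fin (suc (suc n)) → Fin (suc n)
retract i with view i
... | ‵fromℕ     = zero
... | ‵inject₁ j = j

lookup-∷ʳ-last : {A : Set} (xs : Vec A n) (x : A) → lookup (xs ∷ʳ x) (fromℕ n) ≡ x
lookup-∷ʳ-last []       x = refl
lookup-∷ʳ-last (_ ∷ xs) x = lookup-∷ʳ-last xs x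

lookup-∷ʳ-inject₁ : {A : Set} (xs : Vec A n) (x : A) (i : Fin n) →
                    lookup (xs ∷ʳ x) (inject₁ i) ≡ lookup xs i
lookup-∷ʳ-inject₁ (_ ∷ _)  x zero    = refl
lookup-∷ʳ-inject₁ (_ ∷ xs) x (suc i) = lookup-∷ʳ-inject₁ xs x i

lookup-adjoin : {A : Set} (xs : Vec A (suc n)) (i : Fin (suc (suc n))) →
                lookup (xs ∷ʳ lookup xs zero) i ≡ lookup xs (retract i)
lookup-adjoin xs i with view i
... | ‵fromℕ     = lookup-∷ʳ-last xs _
... | ‵inject₁ j = lookup-∷ʳ-inject₁ xs _ j

block-adjoin : (π : Blocks (suc n)) (i : Fin (suc (suc n))) →
               block (adjoinBlocks π) i ≡ adjoin (block π (retract i))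
block-adjoin π i = begin
  lookup (Vec.map adjoin π ∷ʳ adjoin (block π zero)) i
    ≡⟨ cong (λ B → lookup (Vec.map adjoin π ∷ʳ B) i) (lookup-map zero adjoin π) ⟨
  lookup (Vec.map adjoin π ∷ʳ lookup (Vec.map adjoin π) zero) i
    ≡⟨ lookup-adjoin (Vec.map adjoin π) i ⟩
  lookup (Vec.map adjoin π) (retract i)
    ≡⟨ lookup-map (retract i) adjoin π ⟩
  adjoin (block π (retract i)) ∎
  where open ≡-Reasoning

adjoin-isPartition : (π : Blocks (suc n)) → IsPartition π → IsPartition (adjoinBlocks π)
adjoin-isPartition π (refl∼ , same) = here , same′
  where
  here : ∀ i → i ∈ block (adjoinBlocks π) i
  here i = lookup⇒[]= i _ (trans (cong (λ B → lookup B i) (block-adjoin π i))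
    (trans (lookup-adjoin (block π (retract i)) i) ([]=⇒lookup (refl∼ (retract i)))))

  same′ : ∀ i j → j ∈ block (adjoinBlocks π) i →
          block (adjoinBlocks π) i ≡ block (adjoinBlocks π) j
  same′ i j j∈ = begin
    block (adjoinBlocks π) i      ≡⟨ block-adjoin π i ⟩
    adjoin (block π (retract i))  ≡⟨ cong adjoin (same (retract i) (retract j) rj∈) ⟩
    adjoin (block π (retract j))  ≡⟨ block-adjoin π j ⟨
    block (adjoinBlocks π) j      ∎
    where
    open ≡-Reasoning
    rj∈ : retract j ∈ block π (retract i)
    rj∈ = lookup⇒[]= _ _ (trans (sym (lookup-adjoin (block π (retract i)) j))
      (trans (cong (λ B → lookup B j) (sym (block-adjoin π i))) ([]=⇒lookup j∈)))

tilde : 𝒫 (suc n) → 𝒫 (suc (suc n))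
tilde (π , [ p ]) = adjoinBlocks π , [ adjoin-isPartition π p ]

-- For n ≥ 2, PC⁺ n is the disjoint union of PC n and the tilde σ with σ in
-- PC (n - 1); decompose finds which of the two cases applies.
data Decomposition {n} (π : PC⁺ (suc (suc n))) : Set where
  crossing : (ρ : PC (suc (suc n))) → value ρ ≡ value π → Decomposition π
  adjoined : (σ : PC (suc n)) → tilde (value σ) ≡ value π → Decomposition π

Closed : Subset n → Blocks n → Set
Closed S π = ∀ i j → i ∈ S → j ∈ block π i → j ∈ S

sym∼ : (π : Blocks n) → IsPartition π → ∀ {i j} → j ∈ block π i → i ∈ block π j
sym∼ π (refl∼ , same) {i} {j} j∈ = subst (i ∈_) (same i j j∈) (refl∼ i)

trans∼ : (π : Blocks n) → IsPartition π →
         ∀ {i j k} → j ∈ block π i → k ∈ block π j → k ∈ block π i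
trans∼ π (_ , same) {i} {j} {k} j∈ k∈ = subst (k ∈_) (sym (same i j j∈)) k∈

splits⇒closed : (π : 𝒫 n) → IsPartition (value π) →
                ∀ {S} → S Splits π → Closed S (value π)
splits⇒closed π isP (T , e) i j i∈S j∈ with Equivalence.to (e i) i∈S
... | t , t∈T , i∈ = Equivalence.from (e j) (t , t∈T , trans∼ (value π) isP i∈ j∈)

closed⇒splits : (π : 𝒫 n) → IsPartition (value π) →
                ∀ {S} → Closed S (value π) → S Splits π
closed⇒splits π isP {S} closed = S , λ j →
  mk⇔ (λ j∈S → j , j∈S , proj₁ isP j) (λ (i , i∈S , j∈) → closed i j i∈S j∈)

∈interval⁺ : ∀ {p q} {i : Fin n} → p ≤ toℕ i → toℕ i < p + q → i ∈ interval p q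
∈interval⁺ {p = p} {q} {i} p≤i i<p+q = lookup⇒[]= i _ (trans (lookup∘tabulate _ i) eq)
  where
  eq : ⌊ (p ≤? toℕ i) ×-dec (toℕ i <? p + q) ⌋ ≡ true
  eq with (p ≤? toℕ i) ×-dec (toℕ i <? p + q)
  ... | yes _ = refl
  ... | no ¬h = contradiction (p≤i , i<p+q) ¬h

∈interval⁻ : ∀ p q {i : Fin n} → i ∈ interval p q → p ≤ toℕ i × toℕ i < p + q
∈interval⁻ p q {i} i∈ = go (trans (sym (lookup∘tabulate _ i)) ([]=⇒lookup i∈))
  where
  go : ⌊ (p ≤? toℕ i) ×-dec (toℕ i <? p + q) ⌋ ≡ true → p ≤ toℕ i × toℕ i < p + q
  go eq with (p ≤? toℕ i) ×-dec (toℕ i <? p + q)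
  go _  | yes h = h
  go () | no _

restrict : Blocks (suc n) → Blocks n
restrict π = tabulate λ i → tabulate λ j → lookup (block π (inject₁ i)) (inject₁ j)

module _ (π : Blocks (suc n)) where

  lookup-restrict : ∀ i j → lookup (block (restrict π) i) j ≡
                            lookup (block π (inject₁ i)) (inject₁ j)
  lookup-restrict i j =
    trans (cong (λ B → lookup B j) (lookup∘tabulate _ i)) (lookup∘tabulate _ j)

  restrict⁻ : ∀ {i j} → j ∈ block (restrict π) i → inject₁ j ∈ block π (inject₁ i)
  restrict⁻ {i} {j} j∈ =
    lookup⇒[]= _ _ (trans (sym (lookup-restrict i j)) ([]=⇒lookup j∈))

  restrict⁺ : ∀ {i j} → inject₁ j ∈ block π (inject₁ i) → j ∈ block (restrict π) i
  restrict⁺ {i} {j} j∈ =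
    lookup⇒[]= _ _ (trans (lookup-restrict i j) ([]=⇒lookup j∈))

  restrict-isPartition : IsPartition π → IsPartition (restrict π)
  restrict-isPartition (refl∼ , same) = (λ i → restrict⁺ (refl∼ (inject₁ i))) , λ i j j∈ →
    trans (lookup∘tabulate _ i) (trans
      (tabulate-cong λ k → cong (λ B → lookup B (inject₁ k)) (same _ _ (restrict⁻ j∈)))
      (sym (lookup∘tabulate _ j)))

vec-ext : {A : Set} {xs ys : Vec A n} → (∀ i → lookup xs i ≡ lookup ys i) → xs ≡ ys
vec-ext {xs = xs} {ys} eq =
  trans (sym (tabulate∘lookup xs)) (trans (tabulate-cong eq) (tabulate∘lookup ys))

bool-ext : ∀ {x y : Bool} → (x ≡ true → y ≡ true) → (y ≡ true → x ≡ true) → x ≡ y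
bool-ext {true}  {y}     f g = sym (f refl)
bool-ext {false} {true}  f g = g refl
bool-ext {false} {false} f g = refl

module Joined (π : Blocks (suc (suc n))) (isP : IsPartition π)
              (joined : fromℕ (suc n) ∈ block π zero) where

  block-retract : ∀ i → block π (inject₁ (retract i)) ≡ block π i
  block-retract i with view i
  ... | ‵fromℕ     = proj₂ isP _ _ joined
  ... | ‵inject₁ j = refl

  lookup-retract : ∀ k i → lookup (block π k) (inject₁ (retract i)) ≡ lookup (block π k) i
  lookup-retract k i with view i
  ... | ‵inject₁ j = refl
  ... | ‵fromℕ     = bool-ext
    (λ eq → []=⇒lookup (trans∼ π isP (lookup⇒[]= _ _ eq) joined))
    (λ eq → []=⇒lookup (trans∼ π isP (lookup⇒[]= _ _ eq) (sym∼ π isP joined)))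

  adjoin-restrict : adjoinBlocks (restrict π) ≡ π
  adjoin-restrict = vec-ext λ i → vec-ext λ j → begin
    lookup (block (adjoinBlocks (restrict π)) i) j
      ≡⟨ cong (λ B → lookup B j) (block-adjoin (restrict π) i) ⟩
    lookup (adjoin (block (restrict π) (retract i))) j
      ≡⟨ lookup-adjoin (block (restrict π) (retract i)) j ⟩
    lookup (block (restrict π) (retract i)) (retract j)
      ≡⟨ lookup-restrict π (retract i) (retract j) ⟩
    lookup (block π (inject₁ (retract i))) (inject₁ (retract j))
      ≡⟨ lookup-retract (inject₁ (retract i)) j ⟩
    lookup (block π (inject₁ (retract i))) j
      ≡⟨ cong (λ B → lookup B j) (block-retract i) ⟩
    lookup (block π i) j ∎
    where open ≡-Reasoning

  module _ (isPC⁺ : IsPC⁺ (π , [ isP ])) where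

    σ : 𝒫 (suc n)
    σ = restrict π , [ restrict-isPartition π isP ]

    noAdjacent : NoAdjacent σ
    noAdjacent i j eq j∈ = proj₂ isPC⁺ (inject₁ i) (inject₁ j)
      (trans (toℕ-inject₁ j) (trans eq (cong suc (sym (toℕ-inject₁ i))))) (restrict⁻ π j∈)

    endsApart : EndsApart σ
    endsApart zero j _ eq j∈ = proj₂ isPC⁺ (inject₁ j) (fromℕ (suc n))
      (trans (toℕ-fromℕ (suc n)) (trans (sym eq) (cong suc (sym (toℕ-inject₁ j)))))
      (trans∼ π isP (sym∼ π isP (restrict⁻ π j∈)) joined)

    lift-closed : ∀ p q → suc p + q ≤ suc n →
                  Closed (interval (suc p) q) (restrict π) → Closed (interval (suc p) q) π
    lift-closed p q ≤n closed i j i∈ j∈ with view i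
    ... | ‵fromℕ = contradiction
      (subst (_< suc p + q) (toℕ-fromℕ (suc n)) (proj₂ (∈interval⁻ (suc p) q i∈)))
      (ℕ.≤⇒≯ ≤n)
    ... | ‵inject₁ i′ with view j
    ...   | ‵inject₁ j′ =
      let (lo , hi) = ∈interval⁻ (suc p) q (closed i′ j′ i′∈ (restrict⁺ π j∈)) in
      ∈interval⁺ (subst (suc p ≤_) (sym (toℕ-inject₁ j′)) lo)
                 (subst (_< suc p + q) (sym (toℕ-inject₁ j′)) hi)
      where
      i′∈ : i′ ∈ interval (suc p) q
      i′∈ = let (lo , hi) = ∈interval⁻ (suc p) q i∈ in
        ∈interval⁺ (subst (suc p ≤_) (toℕ-inject₁ i′) lo)
                   (subst (_< suc p + q) (toℕ-inject₁ i′) hi)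
    ...   | ‵fromℕ =
      contradiction (proj₁ (∈interval⁻ (suc p) q (closed i′ zero i′∈ zero∈))) λ ()
      where
      i′∈ : i′ ∈ interval (suc p) q
      i′∈ = let (lo , hi) = ∈interval⁻ (suc p) q i∈ in
        ∈interval⁺ (subst (suc p ≤_) (toℕ-inject₁ i′) lo)
                   (subst (_< suc p + q) (toℕ-inject₁ i′) hi)
      zero∈ : zero ∈ block (restrict π) i′
      zero∈ = restrict⁺ π (trans∼ π isP j∈ (sym∼ π isP joined))

    no-closed : ∀ p q → suc p < suc p + q → suc p + q ≤ suc n →
                ¬ Closed (interval (suc p) q) (restrict π)
    no-closed p q p< ≤n closed = proj₁ isPC⁺ (suc p) q p< (ℕ.m≤n⇒m≤1+n ≤n)
      (s≤s (ℕ.≤-trans (ℕ.m≤n+m q (suc p)) ≤n))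
      (closed⇒splits (π , [ isP ]) isP (lift-closed p q ≤n closed))

    -- The complement of an initial interval is an interval avoiding the
    -- first point, and is closed whenever the initial interval is.
    complement-closed : ∀ q → q ≤ suc n → Closed (interval 0 q) (restrict π) →
                        Closed (interval q (suc n ∸ q)) (restrict π)
    complement-closed q q≤ closed i j i∈ j∈ with q ≤? toℕ j
    ... | yes q≤j = ∈interval⁺ q≤j (subst (toℕ j <_) (sym (ℕ.m+[n∸m]≡n q≤)) (toℕ<n j))
    ... | no  q≰j = contradiction (proj₁ (∈interval⁻ q (suc n ∸ q) i∈)) (ℕ.<⇒≱
      (proj₂ (∈interval⁻ 0 q (closed j i (∈interval⁺ z≤n (ℕ.≰⇒> q≰j))
        (sym∼ (restrict π) (restrict-isPartition π isP) j∈)))))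

    noIntervalSplits : NoIntervalSplits σ
    noIntervalSplits (suc p) q p< ≤n _ s =
      no-closed p q p< ≤n (splits⇒closed σ (restrict-isPartition π isP) s)
    noIntervalSplits zero (suc q) _ _ (s≤s q<n) s =
      no-closed q (suc n ∸ suc q)
        (ℕ.m<m+n (suc q) (ℕ.m<n⇒0<n∸m (s≤s q<n)))
        (ℕ.≤-reflexive (ℕ.m+[n∸m]≡n (ℕ.<⇒≤ (s≤s q<n))))
        (complement-closed (suc q) (ℕ.<⇒≤ (s≤s q<n))
          (splits⇒closed σ (restrict-isPartition π isP) s))

    isPC : IsPC σ
    isPC = noIntervalSplits , noAdjacent , endsApart

decompose : (π : PC⁺ (suc (suc n))) → Decomposition π
decompose {n} ((π , [ p ]) , [ q ]) with fromℕ (suc n) ∈? block π zero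
... | yes joined = adjoined (σ , [ isPC q ]) (cong-value adjoin-restrict)
  where
  isP : IsPartition π
  isP = recompute (isPartition? π) p
  open Joined π isP joined using (isPC; adjoin-restrict)
  σ : 𝒫 (suc n)
  σ = restrict π , [ restrict-isPartition π isP ]
  cong-value : ∀ {ρ ρ′ : Blocks (suc (suc n))} .{r : IsPartition ρ} .{r′ : IsPartition ρ′} →
               ρ ≡ ρ′ → _≡_ {A = 𝒫 (suc (suc n))} (ρ , [ r ]) (ρ′ , [ r′ ])
  cong-value refl = refl
... | no ¬joined = crossing ((π , [ p ]) , [ proj₁ q , proj₂ q , endsApart ]) refl
  where
  endsApart : EndsApart (π , [ p ])
  endsApart zero j _ eq j∈ with view j
  ... | ‵fromℕ     = ¬joined j∈
  ... | ‵inject₁ i = contradiction (trans (sym (toℕ-inject₁ i)) (ℕ.suc-injective eq))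
                                   (ℕ.<⇒≢ (toℕ<n i))

module Weights {c ℓ} (R : CommutativeRing c ℓ) where
  open CommutativeRing R hiding (zero) renaming (_+_ to _⊕_; _*_ to _⊛_)
  open MonoidSum +-monoid using (sum⁺-syntax)

  Weight Weight⁺ : Set c
  Weight  = ∀ n → .{{NonZero n}} → PC  n → Carrier
  Weight⁺ = ∀ n → .{{NonZero n}} → PC⁺ n → Carrier

  associated : Weight → Weight⁺
  associated a 1             _ = 1#
  associated a (suc (suc n)) π with decompose π
  ... | crossing ρ _ = a (suc (suc n)) ρ
  ... | adjoined σ _ = a (suc n) σ

  ∑ : {A : Set} → List A → (A → Carrier) → Carrier
  ∑ xs f = List.foldr _⊕_ 0# (List.map f xs)

  total : Weight → ∀ n → .{{NonZero n}} → Carrier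
  total a n = ∑ (allPC n) (a n)

  total⁺ : Weight⁺ → ∀ n → .{{NonZero n}} → Carrier
  total⁺ b n = ∑ (allPC⁺ n) (b n)

  -- Formal power series, given by n ↦ coefficient of x ^ n.
  Series : Set c
  Series = ℕ → Carrier

  infix  4 _≈ₛ_
  infixl 6 _+ₛ_
  infixl 7 _*ₛ_

  _≈ₛ_ : Series → Series → Set ℓ
  f ≈ₛ g = ∀ n → f n ≈ g n

  _+ₛ_ _*ₛ_ : Series → Series → Series
  (f +ₛ g) n = f n ⊕ g n
  (f *ₛ g) n = ∑[ k ≤ n ] (f (toℕ k) ⊛ g (n ∸ toℕ k))

  1ₛ x : Series
  1ₛ 0 = 1#
  1ₛ (suc _) = 0#
  x 1 = 1#
  x _ = 0#

  generating : (∀ n → .{{NonZero n}} → Carrier) → Series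
  generating u 0       = 0#
  generating u (suc n) = u (suc n)

{-# OPTIONS --safe #-}

-- If σ ∈ PC(n - 1), then an interval that splits σ̃ and avoids 1 also avoids n, so
-- it splits σ; an interval that splits σ̃ and contains 1 also contains n, so it is
-- not proper. Condition (c) for σ is what (b) for σ̃ requires at n - 1. Hence σ̃ ∈
-- PC⁺(n), and decompose is a bijection from PC⁺(n) onto the disjoint union of PC(n)
-- and PC(n - 1). It carries b to a, which gives b_n = a_n + a_{n-1}.

module Submission where

open import Defs
open import Algebra.Bundles using (CommutativeRing)
import Algebra.Properties.Monoid.Sum as MonoidSum
open import Data.Bool.Base using (false; true)
open import Data.Fin.Base using (Fin; zero; suc; fromℕ; inject₁)
open import Data.Fin.Properties using (toℕ<n; toℕ-fromℕ; toℕ-inject₁)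
open import Data.Fin.Relation.Unary.Top using (view; view-fromℕ; view-inject₁; ‵fromℕ; ‵inject₁)
open import Data.Fin.Subset using (_∈_)
open import Data.Irrelevant using ([_])
open import Data.List.Base as List using (List; []; _∷_; _++_; filter; foldr)
open import Data.List.Membership.Propositional using () renaming (_∈_ to _∈ₗ_)
open import Data.List.Membership.Propositional.Properties
  using (∈-map⁺; ∈-map⁻; ∈-filter⁺; ∈-++⁺ˡ; ∈-++⁺ʳ; ∈-cartesianProductWith⁺)
open import Data.List.Membership.Propositional.Properties.WithK using (unique∧set⇒bag)
open import Data.List.Properties using (map-∘; map-cong)
open import Data.List.Relation.Binary.BagAndSetEquality using (∼bag⇒↭)
open import Data.List.Relation.Binary.Permutation.Propositional using (_↭_; ↭⇒↭ₛ′)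
import Data.List.Relation.Binary.Permutation.Propositional.Properties as Perm
import Data.List.Relation.Binary.Permutation.Setoid.Properties as PermSetoid
open import Data.List.Relation.Unary.All using ([]; _∷_)
open import Data.List.Relation.Unary.AllPairs using ([]; _∷_)
open import Data.List.Relation.Unary.Any using (here; there)
open import Data.List.Relation.Unary.Unique.Propositional using (Unique)
import Data.List.Relation.Unary.Unique.Propositional.Properties as Uniq
open import Data.Nat.Base as ℕ using (ℕ; zero; suc; _≤_; _<_; z≤n; s≤s)
open import Data.Nat.Properties as ℕ using (_≤?_)
open import Data.Product.Base using (_×_; _,_; proj₁; proj₂)
open import Data.Refinement using (value; _,_)
open import Data.Refinement.Properties using (value-injective)
open import Data.Sum.Base using (_⊎_; inj₁; inj₂; [_,_]′)
open import Data.Sum.Properties using (inj₁-injective; inj₂-injective)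
open import Data.Vec.Base using ([]; _∷_; lookup)
open import Data.Vec.Properties using (∷-injective; lookup⇒[]=; []=⇒lookup)
open import Function.Base using (_∘_)
open import Function.Bundles using (_↔_; mk↔ₛ′; mk⇔; Injection; Inverse)
open import Function.Properties.Inverse using (↔⇒↣)
open import Level using (Level)
open import Relation.Binary.PropositionalEquality
  using (_≡_; refl; sym; trans; cong; cong₂; subst; module ≡-Reasoning)
open import Relation.Nullary using (¬_; yes; no; contradiction)
open import Relation.Nullary.Decidable using (recompute)
open import Relation.Unary using (Pred; Decidable)

private
  variable
    ℓ ℓ′ : Level
    A B : Set ℓ
    n : ℕ

-- Enumerations of finite types.

record Enumerates {A : Set ℓ} (xs : List A) : Set ℓ where
  constructor _,_
  field
    unique   : Unique xs
    complete : ∀ x → x ∈ₗ xs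

open Enumerates

-- In lists without repetition membership determines multiplicity, so two enumerations agree as
-- bags. This makes a sum over a type independent of the list chosen for it.
enumerates-↭ : {xs ys : List A} → Enumerates xs → Enumerates ys → xs ↭ ys
enumerates-↭ (uxs , cxs) (uys , cys) =
  ∼bag⇒↭ (unique∧set⇒bag uxs uys λ {x} → mk⇔ (λ _ → cys x) (λ _ → cxs x))

↔-enumerates : (f : A ↔ B) {xs : List A} →
               Enumerates xs → Enumerates (List.map (Inverse.to f) xs)
↔-enumerates f (u , c) .unique = Uniq.map⁺ (Injection.injective (↔⇒↣ f)) u
↔-enumerates f {xs} (u , c) .complete y =
  subst (_∈ₗ List.map (Inverse.to f) xs) (Inverse.strictlyInverseˡ f y)
    (∈-map⁺ (Inverse.to f) (c (Inverse.from f y)))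

⊎-enumerates : {xs : List A} {ys : List B} → Enumerates xs → Enumerates ys →
               Enumerates (List.map inj₁ xs ++ List.map inj₂ ys)
⊎-enumerates (uxs , cxs) (uys , cys) .unique =
  Uniq.++⁺ (Uniq.map⁺ inj₁-injective uxs) (Uniq.map⁺ inj₂-injective uys) disjoint
  where
  disjoint : ∀ {z} → ¬ (z ∈ₗ List.map inj₁ _ × z ∈ₗ List.map inj₂ _)
  disjoint (z∈₁ , z∈₂) with ∈-map⁻ inj₁ z∈₁ | ∈-map⁻ inj₂ z∈₂
  ... | _ , _ , refl | _ , _ , ()
⊎-enumerates (uxs , cxs) (uys , cys) .complete (inj₁ x) = ∈-++⁺ˡ (∈-map⁺ inj₁ (cxs x))
⊎-enumerates (uxs , cxs) (uys , cys) .complete (inj₂ y) = ∈-++⁺ʳ _ (∈-map⁺ inj₂ (cys y))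

allVecs-enumerates : {xs : List A} → Enumerates xs → ∀ n → Enumerates (allVecs xs n)
allVecs-enumerates e zero    = ([] ∷ []) , λ { [] → here refl }
allVecs-enumerates (u , c) (suc n) with allVecs-enumerates (u , c) n
... | us , cs = Uniq.cartesianProductWith⁺ _∷_ ∷-injective u us ,
                λ { (x ∷ xs) → ∈-cartesianProductWith⁺ _∷_ (c x) (cs xs) }

-- Once the attached proofs are forgotten, uniqueness and membership for `comprehension` reduce to
-- the known facts about `filter`.
map-value-comprehension : {P : Pred A ℓ′} (P? : Decidable P) (xs : List A) →
                          List.map value (comprehension P? xs) ≡ filter P? xs
map-value-comprehension P? []       = refl
map-value-comprehension P? (x ∷ xs) with P? x
... | yes _ = cong (x ∷_) (map-value-comprehension P? xs)
... | no  _ = map-value-comprehension P? xs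

comprehension-enumerates : {P : Pred A ℓ′} (P? : Decidable P) {xs : List A} →
                           Enumerates xs → Enumerates (comprehension P? xs)
comprehension-enumerates P? {xs} (u , c) .unique =
  Uniq.map⁻ (subst Unique (sym (map-value-comprehension P? xs)) (Uniq.filter⁺ P? u))
comprehension-enumerates P? {xs} (u , c) .complete (x , [ p ])
  -- The decision `P? x` turns the irrelevant `p` into a proof that `filter` accepts. The entry
  -- found has value `x`, and irrelevance of its proof identifies it with `(x , [ p ])`.
  with ∈-map⁻ value (subst (x ∈ₗ_) (sym (map-value-comprehension P? xs))
         (∈-filter⁺ P? (c x) (recompute (P? x) p)))
... | _ , y∈ , refl = y∈

all𝒫-enumerates : ∀ n → Enumerates (all𝒫 n)
all𝒫-enumerates n = comprehension-enumerates isPartition?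
  (allVecs-enumerates (allVecs-enumerates bools n) n)
  where
  bools : Enumerates (false ∷ true ∷ [])
  bools = (((λ ()) ∷ []) ∷ [] ∷ []) , λ { false → here refl ; true → there (here refl) }

allPC-enumerates : ∀ n → Enumerates (allPC n)
allPC-enumerates n = comprehension-enumerates isPC? (all𝒫-enumerates n)

allPC⁺-enumerates : ∀ n → Enumerates (allPC⁺ n)
allPC⁺-enumerates n = comprehension-enumerates isPC⁺? (all𝒫-enumerates n)

-- Adjoining a last point and removing it again.

retract-inject₁ : (i : Fin (suc n)) → retract (inject₁ i) ≡ i
retract-inject₁ i rewrite view-inject₁ i = refl

retract-fromℕ : ∀ n → retract (fromℕ (suc n)) ≡ zero
retract-fromℕ n rewrite view-fromℕ n = refl

lookup-adjoinBlocks : (π : Blocks (suc n)) → ∀ i j →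
  lookup (block (adjoinBlocks π) i) j ≡ lookup (block π (retract i)) (retract j)
lookup-adjoinBlocks π i j = trans (cong (λ B → lookup B j) (block-adjoin π i))
                                  (lookup-adjoin (block π (retract i)) j)

-- The two constructions are pullbacks along `inject₁` and `retract`, and `retract ∘ inject₁` is the
-- identity. This left inverse makes `tilde` injective.
restrict-adjoin : (π : Blocks (suc n)) → restrict (adjoinBlocks π) ≡ π
restrict-adjoin π = vec-ext λ i → vec-ext λ j → begin
  lookup (block (restrict (adjoinBlocks π)) i) j
    ≡⟨ lookup-restrict (adjoinBlocks π) i j ⟩
  lookup (block (adjoinBlocks π) (inject₁ i)) (inject₁ j)
    ≡⟨ lookup-adjoinBlocks π (inject₁ i) (inject₁ j) ⟩
  lookup (block π (retract (inject₁ i))) (retract (inject₁ j))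
    ≡⟨ cong₂ (λ i j → lookup (block π i) j) (retract-inject₁ i) (retract-inject₁ j) ⟩
  lookup (block π i) j ∎
  where open ≡-Reasoning

tilde-injective : {σ τ : 𝒫 (suc n)} → tilde σ ≡ tilde τ → σ ≡ τ
tilde-injective {σ = σ} {τ} eq = value-injective (begin
  value σ                          ≡⟨ restrict-adjoin (value σ) ⟨
  restrict (adjoinBlocks (value σ)) ≡⟨ cong (restrict ∘ value) eq ⟩
  restrict (adjoinBlocks (value τ)) ≡⟨ restrict-adjoin (value τ) ⟩
  value τ                          ∎)
  where open ≡-Reasoning

-- Adjoining a last point takes PC into PC⁺.

module _ (σ : Blocks (suc n)) (isP : IsPartition σ) where

  private
    π : Blocks (suc (suc n))
    π = adjoinBlocks σ

    isPπ : IsPartition π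
    isPπ = adjoin-isPartition σ isP

    restricted : ∀ {i j} → inject₁ j ∈ block π (inject₁ i) → j ∈ block σ i
    restricted {i} {j} j∈ = subst (λ ρ → j ∈ block ρ i) (restrict-adjoin σ) (restrict⁺ π j∈)

    extended : ∀ {i j} → j ∈ block σ i → inject₁ j ∈ block π (inject₁ i)
    extended {i} {j} j∈ =
      restrict⁻ π (subst (λ ρ → j ∈ block ρ i) (sym (restrict-adjoin σ)) j∈)

  -- `retract` sends the last point to `zero`, so this is reflexivity of `σ` at `zero`.
  tilde-ends : fromℕ (suc n) ∈ block π zero
  tilde-ends = lookup⇒[]= _ _ (begin
    lookup (block π zero) (fromℕ (suc n))
      ≡⟨ lookup-adjoinBlocks σ zero (fromℕ (suc n)) ⟩
    lookup (block σ zero) (retract (fromℕ (suc n)))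
      ≡⟨ cong (lookup (block σ zero)) (retract-fromℕ n) ⟩
    lookup (block σ zero) zero
      ≡⟨ []=⇒lookup (proj₁ isP zero) ⟩
    true ∎)
    where open ≡-Reasoning

  tilde-noAdjacent : NoAdjacent (σ , [ isP ]) → EndsApart (σ , [ isP ]) →
                     NoAdjacent (π , [ isPπ ])
  tilde-noAdjacent noAdj ends i j eq j∈ with view i | view j
  ... | ‵fromℕ | _ =
    ℕ.<⇒≢ (toℕ<n j) (trans eq (cong suc (toℕ-fromℕ (suc n))))
  ... | ‵inject₁ i | ‵inject₁ j = noAdj i j
    (trans (sym (toℕ-inject₁ j)) (trans eq (cong suc (toℕ-inject₁ i)))) (restricted j∈)
  -- Here `i` is the last point of `σ`. In `π` it is related to the new last point, hence to `zero`,
  -- which `ends` forbids.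
  ... | ‵inject₁ i | ‵fromℕ = ends zero i refl
    (trans (cong suc (sym (toℕ-inject₁ i))) (trans (sym eq) (toℕ-fromℕ (suc n))))
    (sym∼ σ isP (restricted (trans∼ π isPπ j∈ (sym∼ π isPπ tilde-ends))))

  -- `inject₁` preserves `toℕ`, so the interval in `σ` is the preimage of the one in `π` with the
  -- same bounds.
  restrict-closed : ∀ {p q} → Closed (interval p q) π → Closed (interval p q) σ
  restrict-closed {p} {q} closed i j i∈ j∈ =
    let (lo , hi) = ∈interval⁻ p q i∈
        (lo′ , hi′) = ∈interval⁻ p q (closed (inject₁ i) (inject₁ j)
          (∈interval⁺ (subst (p ≤_) (sym (toℕ-inject₁ i)) lo)
                      (subst (_< p ℕ.+ q) (sym (toℕ-inject₁ i)) hi))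
          (extended j∈))
    in ∈interval⁺ (subst (p ≤_) (toℕ-inject₁ j) lo′) (subst (_< p ℕ.+ q) (toℕ-inject₁ j) hi′)

  tilde-noIntervalSplits : NoIntervalSplits (σ , [ isP ]) → NoIntervalSplits (π , [ isPπ ])
  -- As `0 < q`, the interval contains `zero`, so closure forces in the last point, of index
  -- `suc n`. This would give `suc n < q`, against `q ≤ suc n`.
  tilde-noIntervalSplits noSplits zero q 0<q _ q<n s = ℕ.<⇒≱
    (subst (_< q) (toℕ-fromℕ (suc n))
      (proj₂ (∈interval⁻ 0 q (splits⇒closed (π , [ isPπ ]) isPπ s zero (fromℕ (suc n))
        (∈interval⁺ z≤n 0<q) tilde-ends))))
    (ℕ.≤-pred q<n)
  tilde-noIntervalSplits noSplits (suc p) q p< p+q≤ q<n s =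
    -- Properness in `σ`, that is `q < suc n`, follows from `suc p + q ≤ suc n` because the interval
    -- starts after `zero`.
    noSplits (suc p) q p< p+q≤′ (ℕ.≤-trans (s≤s (ℕ.m≤n+m q p)) p+q≤′)
      (closed⇒splits (σ , [ isP ]) isP (restrict-closed closed))
    where
    closed : Closed (interval (suc p) q) π
    closed = splits⇒closed (π , [ isPπ ]) isPπ s

    last∉ : ¬ (fromℕ (suc n) ∈ interval (suc p) q)
    last∉ last∈ with () ← proj₁ (∈interval⁻ (suc p) q {zero {suc n}}
      (closed (fromℕ (suc n)) zero last∈ (sym∼ π isPπ tilde-ends)))

    p+q≤′ : suc p ℕ.+ q ≤ suc n
    p+q≤′ with suc p ℕ.+ q ≤? suc n
    ... | yes h = h
    -- An interval reaching beyond `suc n` would contain the last point: nonemptiness `p<` and the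
    -- bound `p+q≤` give `suc p ≤ suc n`, the index of that point.
    ... | no ¬h = contradiction
      (∈interval⁺ (subst (suc p ≤_) (sym (toℕ-fromℕ (suc n))) (ℕ.≤-pred (ℕ.≤-trans p< p+q≤)))
                  (subst (_< suc p ℕ.+ q) (sym (toℕ-fromℕ (suc n))) (ℕ.≰⇒> ¬h)))
      last∉

  tilde-isPC⁺ : IsPC (σ , [ isP ]) → IsPC⁺ (π , [ isPπ ])
  tilde-isPC⁺ (noSplits , noAdj , ends) =
    tilde-noIntervalSplits noSplits , tilde-noAdjacent noAdj ends

-- The bijection from PC⁺ onto the disjoint union.

summand : {π : PC⁺ (suc (suc n))} → Decomposition π → PC (suc (suc n)) ⊎ PC (suc n)
summand (crossing ρ _) = inj₁ ρ
summand (adjoined σ _) = inj₂ σ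

assemble : PC (suc (suc n)) ⊎ PC (suc n) → PC⁺ (suc (suc n))
assemble (inj₁ (ρ , [ isPC ]))           = ρ , [ proj₁ isPC , proj₁ (proj₂ isPC) ]
assemble (inj₂ ((σ , [ isP ]) , [ isPC ])) =
  tilde (σ , [ isP ]) , [ tilde-isPC⁺ σ isP isPC ]

-- Each constructor carries the equation of underlying partitions, and the attached proofs are
-- irrelevant. The arbitrary `d` allows matching without unfolding `decompose`.
assemble-summand : {π : PC⁺ (suc (suc n))} (d : Decomposition π) → assemble (summand d) ≡ π
assemble-summand (crossing ρ eq) = value-injective eq
assemble-summand (adjoined σ eq) = value-injective eq

-- Condition (c) forbids the relation between first and last point that `tilde-ends` provides.
tilde-notPC : (ρ : PC (suc (suc n))) (σ : PC (suc n)) → ¬ (value ρ ≡ tilde (value σ))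
tilde-notPC {n} (_ , [ isPC ]) ((σ , [ isP ]) , _) refl =
  proj₂ (proj₂ (recompute (isPC? (tilde (σ , [ isP ]))) isPC)) zero (fromℕ (suc n)) refl
    (cong suc (toℕ-fromℕ (suc n))) (tilde-ends σ (recompute (isPartition? σ) isP))

assemble-injective : {x y : PC (suc (suc n)) ⊎ PC (suc n)} → assemble x ≡ assemble y → x ≡ y
assemble-injective {x = inj₁ _} {inj₁ _} eq = cong inj₁ (value-injective (cong value eq))
assemble-injective {x = inj₂ _} {inj₂ _} eq =
  cong inj₂ (value-injective (tilde-injective (cong value eq)))
assemble-injective {x = inj₁ ρ} {inj₂ σ} eq = contradiction (cong value eq) (tilde-notPC ρ σ)
assemble-injective {x = inj₂ σ} {inj₁ ρ} eq =
  contradiction (sym (cong value eq)) (tilde-notPC ρ σ)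

decomposition↔ : PC⁺ (suc (suc n)) ↔ (PC (suc (suc n)) ⊎ PC (suc n))
decomposition↔ = mk↔ₛ′ (summand ∘ decompose) assemble
  -- By `assemble-summand`, both sides have the same image under `assemble`, which is injective.
  (λ x → assemble-injective (assemble-summand (decompose (assemble x))))
  (λ π → assemble-summand (decompose π))

-- Sums in a commutative ring and generating series.

module _ {c ℓ} (R : CommutativeRing c ℓ) where
  open CommutativeRing R hiding (zero; refl; sym; trans) renaming (_+_ to _⊕_; _*_ to _⊛_)
  private module ≈ = CommutativeRing R
  open Weights R
  open MonoidSum +-monoid using (sum; sum-cong-≋; sum-replicate-zero)
  open import Relation.Binary.Reasoning.Setoid setoid

  ∑-++ : {A : Set} (xs ys : List A) (f : A → Carrier) →
         ∑ (xs ++ ys) f ≈ ∑ xs f ⊕ ∑ ys f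
  ∑-++ []       ys f = ≈.sym (+-identityˡ _)
  ∑-++ (x ∷ xs) ys f = ≈.trans (+-congˡ (∑-++ xs ys f)) (≈.sym (+-assoc _ _ _))

  ∑-map : {A B : Set} (g : A → B) (xs : List A) (f : B → Carrier) →
          ∑ (List.map g xs) f ≡ ∑ xs (f ∘ g)
  ∑-map g xs f = cong (foldr _⊕_ 0#) (sym (map-∘ xs))

  ∑-↭ : {A : Set} {xs ys : List A} (f : A → Carrier) → xs ↭ ys → ∑ xs f ≈ ∑ ys f
  ∑-↭ f xs↭ys = PermSetoid.foldr-commMonoid setoid +-isCommutativeMonoid
    (↭⇒↭ₛ′ isEquivalence (Perm.map⁺ f xs↭ys))

  -- The image of `xs` under `g` enumerates `B`, as `ys` does, so the two lists are permutations of
  -- each other and commutativity of addition applies.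
  ∑-↔ : {A B : Set} (g : A ↔ B) {xs : List A} {ys : List B} → Enumerates xs → Enumerates ys →
        (f : B → Carrier) → ∑ xs (f ∘ Inverse.to g) ≈ ∑ ys f
  ∑-↔ g {xs} exs eys f = ≈.trans (reflexive (sym (∑-map (Inverse.to g) xs f)))
    (∑-↭ f (enumerates-↭ (↔-enumerates g exs) eys))

  sum-zero : ∀ n (f : Fin n → Carrier) → (∀ k → f k ≈ 0#) → sum f ≈ 0#
  sum-zero n f f≈0 = ≈.trans (sum-cong-≋ f≈0) (sum-replicate-zero n)

  -- All coefficients of `1ₛ +ₛ x` beyond the first two vanish; at index `suc n` the Cauchy product
  -- contains both of the remaining terms.
  [1+x]* : (f : Series) → ∀ n → ((1ₛ +ₛ x) *ₛ f) (suc n) ≈ f (suc n) ⊕ f n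
  [1+x]* f n = +-cong
    (≈.trans (*-congʳ (+-identityʳ 1#)) (*-identityˡ _))
    (≈.trans (+-cong (≈.trans (*-congʳ (+-identityˡ 1#)) (*-identityˡ _))
                     (sum-zero n _ λ k → ≈.trans (*-congʳ (+-identityˡ 0#)) (zeroˡ _)))
             (+-identityʳ _))

  module _ (a : Weight) where

    -- Exhibits `b` as a function composed with the bijection, the form in which `∑-↔` can transport
    -- the sum.
    associated-summand : ∀ n (π : PC⁺ (suc (suc n))) →
      associated a (suc (suc n)) π ≡ [ a (suc (suc n)) , a (suc n) ]′ (summand (decompose π))
    associated-summand n π with decompose π
    ... | crossing ρ _ = refl
    ... | adjoined σ _ = refl

    total⁺-one : total⁺ (associated a) 1 ≈ 1#
    -- allPC⁺ 1 evaluates to a list with one element, and allPC 1 (in generating-identity) to [].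
    total⁺-one = +-identityʳ 1#

    total⁺-step : ∀ n → total⁺ (associated a) (suc (suc n)) ≈
                        total a (suc (suc n)) ⊕ total a (suc n)
    total⁺-step n = begin
      ∑ (allPC⁺ (suc (suc n))) (associated a (suc (suc n)))
        ≡⟨ cong (foldr _⊕_ 0#) (map-cong (associated-summand n) (allPC⁺ (suc (suc n)))) ⟩
      ∑ (allPC⁺ (suc (suc n))) (weight ∘ summand ∘ decompose)
        ≈⟨ ∑-↔ decomposition↔ (allPC⁺-enumerates _)
             (⊎-enumerates (allPC-enumerates _) (allPC-enumerates _)) weight ⟩
      ∑ (List.map inj₁ (allPC (suc (suc n))) ++ List.map inj₂ (allPC (suc n))) weight
        ≈⟨ ∑-++ (List.map inj₁ (allPC (suc (suc n)))) _ weight ⟩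
      ∑ (List.map inj₁ (allPC (suc (suc n)))) weight ⊕ ∑ (List.map inj₂ (allPC (suc n))) weight
        ≡⟨ cong₂ _⊕_ (∑-map inj₁ (allPC (suc (suc n))) weight) (∑-map inj₂ (allPC (suc n)) weight) ⟩
      total a (suc (suc n)) ⊕ total a (suc n) ∎
      where
      weight : PC (suc (suc n)) ⊎ PC (suc n) → Carrier
      weight = [ a (suc (suc n)) , a (suc n) ]′

    generating-identity : generating (total⁺ (associated a)) ≈ₛ
                          x +ₛ (1ₛ +ₛ x) *ₛ generating (total a)
    -- Both `x` and `generating (total a)` have constant coefficient `0#`.
    generating-identity 0 =
      ≈.sym (≈.trans (+-identityˡ _) (≈.trans (+-identityʳ _) (zeroʳ _)))
    generating-identity 1 = begin
      total⁺ (associated a) 1 ≈⟨ total⁺-one ⟩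
      1#                      ≈⟨ +-identityʳ 1# ⟨
      1# ⊕ 0#                 ≈⟨ +-congˡ (+-identityʳ 0#) ⟨
      -- The inner `0#` is the constant coefficient of `generating (total a)`, in the place of a
      -- term a_0.
      1# ⊕ (total a 1 ⊕ 0#)   ≈⟨ +-congˡ ([1+x]* (generating (total a)) 0) ⟨
      1# ⊕ ((1ₛ +ₛ x) *ₛ generating (total a)) 1 ∎
    generating-identity (suc (suc n)) = begin
      total⁺ (associated a) (suc (suc n))     ≈⟨ total⁺-step n ⟩
      total a (suc (suc n)) ⊕ total a (suc n) ≈⟨ [1+x]* (generating (total a)) (suc n) ⟨
      -- From degree 2 on, the summand `x` contributes `0#`.
      ((1ₛ +ₛ x) *ₛ generating (total a)) (suc (suc n)) ≈⟨ +-identityˡ _ ⟨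
      0# ⊕ ((1ₛ +ₛ x) *ₛ generating (total a)) (suc (suc n)) ∎

lemma2p3 : ∀ {c ℓ} (R : CommutativeRing c ℓ) →
    let open CommutativeRing R
        open Weights R in
    (a : Weight) →
    let b = associated a in
    (total⁺ b 1 ≈ 1#)
    × ((n : ℕ) → total⁺ b (suc (suc n)) ≈ total a (suc (suc n)) + total a (suc n))
    × (generating (total⁺ b) ≈ₛ x +ₛ (1ₛ +ₛ x) *ₛ generating (total a))
lemma2p3 R a = total⁺-one R a , total⁺-step R a , generating-identity R a
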